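{- Let $n \in \mathbb{N}$ with $n \geqslant 136$, and let $\mathcal{G}$ be a collection of ordered graphs on $[n]$. If $|\mathcal{G}| < n$, then $|\partial \mathcal{G}| \geqslant |\mathcal{G}|$.
   Context: An ordered graph is a graph together with a linear order on its vertex set; an ordered graph with $n$ vertices is identified with an ordered graph on $[n]=\{1,\ldots,n\}$ with the usual order (two ordered graphs are equal if the unique order-preserving bijection between their vertex sets is a graph isomorphism). For an ordered graph $G$ and $v \in V(G)$, $G - v$ is the ordered graph induced on $V(G)\setminus\{v\}$ with the inherited order. The shadow of $G$ is $\partial G = \{G - v : v \in V(G)\}$, and for a collection $\mathcal{G}$ of ordered graphs, $\partial\mathcal{G} = \bigcup_{G \in \mathcal{G}} \partial G$. -}

module Defs where

open import Data.Nat using (ℕ; suc)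
open import Data.Bool using (Bool; false)
open import Data.Fin using (Fin)
open import Data.Vec using (Vec; lookup; removeAt; map)
open import Data.List using (List)
open import Data.List.Membership.Propositional using (_∈_)
open import Data.Product using (Σ; _×_; ∃)
open import Relation.Binary.PropositionalEquality using (_≡_)

-- An ordered graph on [n] (vertices Fin n, ordered as usual), given by its
-- adjacency matrix.  Since the only order-preserving bijection [n] → [n] is the
-- identity, two ordered graphs on [n] are equal iff their adjacency matrices
-- are equal, so propositional equality of matrices is the right equality.
AdjMat : ℕ → Set
AdjMat n = Vec (Vec Bool n) n

adj : ∀ {n} → AdjMat n → Fin n → Fin n → Bool
adj A i j = lookup (lookup A i) j

IsGraph : ∀ {n} → AdjMat n → Set
IsGraph {n} A = (∀ (i j : Fin n) → adj A i j ≡ adj A j i) × (∀ (i : Fin n) → adj A i i ≡ false)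

delete : ∀ {m} → AdjMat (suc m) → Fin (suc m) → AdjMat m
delete A v = map (λ row → removeAt row v) (removeAt A v)

InShadow : ∀ {m} → List (AdjMat (suc m)) → AdjMat m → Set
InShadow {m} 𝒢 H = Σ (AdjMat (suc m)) λ G → (G ∈ 𝒢) × ∃ λ (v : Fin (suc m)) → delete G v ≡ H

{-# OPTIONS --safe #-}
module Submission where

-- Fix an interval I of m vertices and delete only vertices of I.  If nothing but the
-- subgraphs induced on I distinguishes the members of 𝒢 and the vertices of I (𝒢 is
-- uniform on I), the shadow has at least min(|𝒢|, m − 1) elements; otherwise it has
-- at least min(|𝒢|, m).  The uniform bound follows from the other one for I minus its
-- first vertex v: if 𝒢 is uniform there, then deleting v is injective on 𝒢.
--
-- In the non-uniform case either two members differ outside I, and 𝒢 is split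
-- accordingly into parts with disjoint shadows, or adjacency to some outer vertex z
-- colours the vertices of I non-constantly.  One may assume that all first vertices
-- have the same colour a; group 𝒢 by the position p of the first vertex not coloured a.
-- Deletions before p lower p by one and deletions after p preserve it.  Take the least
-- q such that at least q members have at most q leading vertices coloured a: smaller
-- classes satisfy the inductive bound on the deletions before p, and at q itself the
-- deletions before p and those after p in all later classes together suffice.

open import Defs
open import Data.Nat using (ℕ; zero; suc; pred; _+_; _∸_; _⊓_; _≤_; _<_; z≤n; s≤s; _≤?_; _<?_; _≟_)
open import Data.Nat.Properties
open import Data.Nat.Induction using (<-rec)
open import Data.Bool using (Bool; true; false; not)
import Data.Bool.Properties as Bool
open import Data.Empty using (⊥-elim)
open import Data.Fin using (Fin; zero; suc; toℕ; fromℕ<)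
open import Data.Fin.Properties using (injective⇒≤; toℕ-fromℕ<)
open import Data.List using (List; []; _∷_; length; filter; map; lookup)
open import Data.List.Properties using (length-map)
open import Data.List.Relation.Unary.All using (All; _∷_)
import Data.List.Relation.Unary.All as All
open import Data.List.Relation.Unary.AllPairs using (AllPairs; []; _∷_)
import Data.List.Relation.Unary.AllPairs as AllPairs
import Data.List.Relation.Unary.AllPairs.Properties as AllPairsₚ
open import Data.List.Relation.Unary.Any using (here; there; index)
open import Data.List.Relation.Unary.Any.Properties using (lookup-index)
open import Data.List.Relation.Unary.Unique.Propositional using (Unique)
open import Data.List.Membership.Propositional using (_∈_)
open import Data.List.Membership.Propositional.Properties
  using (∈-filter⁺; ∈-filter⁻; ∈-map⁺; ∈-map⁻; ∈-lookup)
open import Data.Product using (∃; _×_; _,_; proj₁; proj₂)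
open import Data.Sum using (_⊎_; inj₁; inj₂; [_,_]′)
open import Data.Vec using (Vec; []; _∷_; removeAt; replicate)
import Data.Vec as Vec
open import Function using (_∘_; id; case_of_)
open import Function.Bundles using (_⇔_; Equivalence)
open import Relation.Binary.PropositionalEquality
open import Relation.Nullary using (¬_; yes; no; contradiction)
open import Relation.Nullary.Decidable using (decidable-stable)
open import Relation.Unary using (Pred; Decidable)
open import Level using (0ℓ)

-- Inequalities of naturals are stable, so classical case distinctions may be used to prove them.
≤-by-cases : (P : Set) {k l : ℕ} → (P → k ≤ l) → (¬ P → k ≤ l) → k ≤ l
≤-by-cases P {k} {l} p⇒ ¬p⇒ with k ≤? l
... | yes k≤l = k≤l
... | no  k≰l = ¬p⇒ (k≰l ∘ p⇒)

-- Counting in filtered lists, and truncated sums.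

module _ {A : Set} where

  length-filter-⊎ : {P Q R : Pred A 0ℓ} (P? : Decidable P) (Q? : Decidable Q) (R? : Decidable R) →
    (∀ {x} → P x → R x) → (∀ {x} → Q x → R x) → (∀ {x} → R x → P x ⊎ Q x) →
    (∀ {x} → P x → ¬ Q x) →
    ∀ xs → length (filter R? xs) ≡ length (filter P? xs) + length (filter Q? xs)
  length-filter-⊎ P? Q? R? P⇒R Q⇒R R⇒P⊎Q P⇒¬Q [] = refl
  length-filter-⊎ P? Q? R? P⇒R Q⇒R R⇒P⊎Q P⇒¬Q (x ∷ xs)
    with ih ← length-filter-⊎ P? Q? R? P⇒R Q⇒R R⇒P⊎Q P⇒¬Q xs | P? x | Q? x | R? x
  ... | yes p | yes q | _     = contradiction q (P⇒¬Q p)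
  ... | yes p | no ¬q | yes r = cong suc ih
  ... | yes p | no ¬q | no ¬r = contradiction (P⇒R p) ¬r
  ... | no ¬p | yes q | yes r = trans (cong suc ih) (sym (+-suc _ _))
  ... | no ¬p | yes q | no ¬r = contradiction (Q⇒R q) ¬r
  ... | no ¬p | no ¬q | yes r = ⊥-elim ([ ¬p , ¬q ]′ (R⇒P⊎Q r))
  ... | no ¬p | no ¬q | no ¬r = ih

  length-split : {P Q : Pred A 0ℓ} (P? : Decidable P) (Q? : Decidable Q) →
    (∀ {x} → P x → ¬ Q x) → (∀ {x} → ¬ P x → Q x) →
    ∀ xs → length xs ≡ length (filter P? xs) + length (filter Q? xs)
  length-split P? Q? P⇒¬Q ¬P⇒Q [] = refl
  length-split P? Q? P⇒¬Q ¬P⇒Q (x ∷ xs)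
    with ih ← length-split P? Q? P⇒¬Q ¬P⇒Q xs | P? x | Q? x
  ... | yes p | yes q = contradiction q (P⇒¬Q p)
  ... | yes p | no ¬q = cong suc ih
  ... | no ¬p | yes q = trans (cong suc ih) (sym (+-suc _ _))
  ... | no ¬p | no ¬q = contradiction (¬P⇒Q ¬p) ¬q

  ∈⇒0<length : ∀ {x : A} {xs} → x ∈ xs → 0 < length xs
  ∈⇒0<length (here _)  = s≤s z≤n
  ∈⇒0<length (there _) = s≤s z≤n

  0<length⇒∈ : ∀ (xs : List A) → 0 < length xs → ∃ λ x → x ∈ xs
  0<length⇒∈ (x ∷ xs) _ = x , here refl

  lookup-injective : ∀ {_≈_ : A → A → Set} → (∀ {x y} → x ≈ y → y ≈ x) →
    ∀ {xs} → AllPairs (λ x y → ¬ x ≈ y) xs →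
    ∀ i j → lookup xs i ≈ lookup xs j → i ≡ j
  lookup-injective ≈-sym (_ ∷ _) zero    zero    _ = refl
  lookup-injective ≈-sym (x≉ ∷ _) zero   (suc j) e = contradiction e (All.lookup x≉ (∈-lookup j))
  lookup-injective ≈-sym (x≉ ∷ _) (suc i) zero   e = contradiction (≈-sym e) (All.lookup x≉ (∈-lookup i))
  lookup-injective ≈-sym (_ ∷ xs!) (suc i) (suc j) e = cong suc (lookup-injective ≈-sym xs! i j e)

length-below-suc : ∀ {A : Set} (f : A → ℕ) b xs →
  length (filter (λ x → f x <? suc b) xs) ≡
  length (filter (λ x → f x <? b) xs) + length (filter (λ x → f x ≟ b) xs)
length-below-suc f b = length-filter-⊎ _ _ _
  m≤n⇒m≤1+n (λ e → s≤s (≤-reflexive e)) (λ { (s≤s l) → m≤n⇒m<n∨m≡n l }) (λ l e → <⇒≢ l e)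

length-below-mono : ∀ {A B : Set} (f : A → ℕ) (g : B → ℕ) xs ys b →
  (∀ {c} → c < b → length (filter (λ x → f x ≟ c) xs) ≤ length (filter (λ y → g y ≟ c) ys)) →
  length (filter (λ x → f x <? b) xs) ≤ length (filter (λ y → g y <? b) ys)
length-below-mono f g xs ys zero _ = ≤-trans (≤-reflexive (none xs)) z≤n
  where
  none : ∀ xs → length (filter (λ x → f x <? zero) xs) ≡ 0
  none []       = refl
  none (x ∷ xs) = none xs
length-below-mono f g xs ys (suc b) h
  rewrite length-below-suc f b xs | length-below-suc g b ys =
  +-mono-≤ (length-below-mono f g xs ys b (h ∘ m≤n⇒m≤1+n)) (h ≤-refl)

least : {Q : Pred ℕ 0ℓ} → Decidable Q → ∀ b →
  (∃ λ r → r < b × Q r × (∀ {c} → c < r → ¬ Q c)) ⊎ (∀ {c} → c < b → ¬ Q c)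
least Q? zero = inj₂ λ ()
least Q? (suc b) with least Q? b
... | inj₁ (r , r<b , q , min) = inj₁ (r , m≤n⇒m≤1+n r<b , q , min)
... | inj₂ none with Q? b
...   | yes q = inj₁ (b , ≤-refl , q , none)
...   | no ¬q = inj₂ λ { (s≤s c≤b) → [ none , (λ { refl → ¬q }) ]′ (m≤n⇒m<n∨m≡n c≤b) }

-- If `y ≤ k`, then `y` is not truncated and `t + y` is reached. Otherwise `y` contributes `k`, and
-- `t + x ⊓ q` reaches `q` whichever of `x`, `q` is smaller.
⊓-sum-left : ∀ {t x y q k m} → q ≤ t + x → m ≤ q + k → (t + y) ⊓ m ≤ t + x ⊓ q + y ⊓ k
⊓-sum-left {t} {x} {y} {q} {k} {m} q≤t+x m≤q+k with ≤-total y k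
... | inj₁ y≤k = begin
  (t + y) ⊓ m       ≤⟨ m⊓n≤m _ _ ⟩
  t + y             ≤⟨ +-monoˡ-≤ y (m≤m+n t _) ⟩
  t + x ⊓ q + y     ≡⟨ cong (t + x ⊓ q +_) (m≤n⇒m⊓n≡m y≤k) ⟨
  t + x ⊓ q + y ⊓ k ∎
  where open ≤-Reasoning
... | inj₂ k≤y = begin
  (t + y) ⊓ m       ≤⟨ m⊓n≤n (t + y) m ⟩
  m                 ≤⟨ m≤q+k ⟩
  q + k             ≤⟨ +-monoˡ-≤ k q≤t+x⊓q ⟩
  t + x ⊓ q + k     ≡⟨ cong (t + x ⊓ q +_) (m≥n⇒m⊓n≡n k≤y) ⟨
  t + x ⊓ q + y ⊓ k ∎
  where
  open ≤-Reasoning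
  q≤t+x⊓q : q ≤ t + x ⊓ q
  q≤t+x⊓q with ≤-total x q
  ... | inj₁ x≤q = ≤-trans q≤t+x (≤-reflexive (cong (t +_) (sym (m≤n⇒m⊓n≡m x≤q))))
  ... | inj₂ q≤x = ≤-trans (m≤n+m q t) (≤-reflexive (cong (t +_) (sym (m≥n⇒m⊓n≡n q≤x))))

-- A summand that fills its cap `k` leaves the other to add at least one; if neither does, nothing
-- is lost. Splitting into two nonempty parts thus raises a cap by one.
⊓-sum-suc : ∀ {a b k} → 0 < a → 0 < b → 0 < k → (a + b) ⊓ suc k ≤ a ⊓ k + b ⊓ k
⊓-sum-suc {a} {b} {k} 0<a 0<b 0<k with ≤-total a k
... | inj₂ k≤a = begin
  (a + b) ⊓ suc k ≤⟨ m⊓n≤n (a + b) (suc k) ⟩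
  suc k           ≡⟨ +-comm 1 k ⟩
  k + 1           ≤⟨ +-monoʳ-≤ k (⊓-glb 0<b 0<k) ⟩
  k + b ⊓ k       ≡⟨ cong (_+ b ⊓ k) (m≥n⇒m⊓n≡n k≤a) ⟨
  a ⊓ k + b ⊓ k   ∎
  where open ≤-Reasoning
... | inj₁ a≤k rewrite m≤n⇒m⊓n≡m a≤k with ≤-total b k
...   | inj₁ b≤k rewrite m≤n⇒m⊓n≡m b≤k = m⊓n≤m _ _
...   | inj₂ k≤b rewrite m≥n⇒m⊓n≡n k≤b = ≤-trans (m⊓n≤n (a + b) (suc k)) (+-monoˡ-≤ k 0<a)

-- Digraphs on the naturals, deletion and intervals.

Digraph : Set
Digraph = ℕ → ℕ → Bool

infix 4 _≐_
_≐_ : Digraph → Digraph → Set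
G ≐ G′ = ∀ i j → G i j ≡ G′ i j

-- The ℕ-indexed punchIn.
skip : ℕ → ℕ → ℕ
skip zero    i       = suc i
skip (suc v) zero    = zero
skip (suc v) (suc i) = suc (skip v i)

skip-< : ∀ {v i} → i < v → skip v i ≡ i
skip-< {suc v} {zero}  _         = refl
skip-< {suc v} {suc i} (s≤s i<v) = cong suc (skip-< i<v)

skip-≥ : ∀ {v i} → v ≤ i → skip v i ≡ suc i
skip-≥ {zero}              _         = refl
skip-≥ {suc v} {suc i} (s≤s v≤i) = cong suc (skip-≥ v≤i)

del : ℕ → Digraph → Digraph
del v G i j = G (skip v i) (skip v j)

orient : Bool → Digraph → Digraph
orient true  G i j = G i j
orient false G i j = G j i

orient-del : ∀ d {v G H} → del v G ≐ H → ∀ i j → orient d H i j ≡ orient d G (skip v i) (skip v j)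
orient-del true  e i j = sym (e i j)
orient-del false e i j = sym (e j i)

-- Intervals are half-open: [α, α + m).
In Out : ℕ → ℕ → ℕ → Set
In  α m v = α ≤ v × v < α + m
Out α m z = z < α ⊎ α + m ≤ z

in-or-out : ∀ α m z → In α m z ⊎ Out α m z
in-or-out α m z with α ≤? z | z <? α + m
... | no α≰z  | _     = inj₂ (inj₁ (≰⇒> α≰z))
... | yes _   | no ≮  = inj₂ (inj₂ (≮⇒≥ ≮))
... | yes α≤z | yes < = inj₁ (α≤z , <)

-- Containment only: `S` may hold further digraphs, so that the interval can be shrunk and both
-- lists filtered.
Covers : ℕ → ℕ → List Digraph → List Digraph → Set
Covers α m 𝒢 S = ∀ {G v} → G ∈ 𝒢 → In α m v → ∃ λ H → H ∈ S × del v G ≐ H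

Distinct : List Digraph → Set
Distinct = AllPairs (λ G G′ → ¬ G ≐ G′)

-- The members of 𝒢 agree up to their restrictions to the interval, all of whose
-- vertices look the same from outside.
record Uniform (α m : ℕ) (𝒢 : List Digraph) : Set where
  field
    outer : ∀ {G G′ z z′} → G ∈ 𝒢 → G′ ∈ 𝒢 → Out α m z → Out α m z′ → G z z′ ≡ G′ z z′
    cross : ∀ d {G G′ z u v} → G ∈ 𝒢 → G′ ∈ 𝒢 → Out α m z → In α m u → In α m v →
      orient d G z u ≡ orient d G′ z v
open Uniform

uniform-ext : ∀ {α m 𝒢 G G′} → Uniform α m 𝒢 → G ∈ 𝒢 → G′ ∈ 𝒢 →
  (∀ {i j} → In α m i → In α m j → G i j ≡ G′ i j) → G ≐ G′
uniform-ext {α} {m} U G∈ G′∈ inner i j with in-or-out α m i | in-or-out α m j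
... | inj₁ i∈ | inj₁ j∈ = inner i∈ j∈
... | inj₁ i∈ | inj₂ j∉ = cross U false G∈ G′∈ j∉ i∈ i∈
... | inj₂ i∉ | inj₁ j∈ = cross U true G∈ G′∈ i∉ j∈ j∈
... | inj₂ i∉ | inj₂ j∉ = outer U G∈ G′∈ i∉ j∉

-- Deleting a vertex before the interval shifts the interval down by one but keeps its induced
-- subgraph, and uniformity makes everything else common to all members.
uniform-del-injective : ∀ {α m 𝒢 G G′ H v} → Uniform α m 𝒢 → v < α → G ∈ 𝒢 → G′ ∈ 𝒢 →
  del v G ≐ H → del v G′ ≐ H → G ≐ G′
uniform-del-injective {α} {m} {v = v} U v<α G∈ G′∈ e e′ = uniform-ext U G∈ G′∈ inner
  where
  inner : ∀ {i j} → In α m i → In α m j → _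
  inner {zero} (α≤i , _) _ = contradiction (≤-trans v<α α≤i) λ ()
  inner {suc i} {zero} _ (α≤j , _) = contradiction (≤-trans v<α α≤j) λ ()
  inner {suc i} {suc j} (α≤i , _) (α≤j , _) with e i j | e′ i j
  ... | p | p′ rewrite skip-≥ {v} {i} (≤-pred (≤-trans v<α α≤i))
                     | skip-≥ {v} {j} (≤-pred (≤-trans v<α α≤j)) = trans p (sym p′)

length-≤-injection : ∀ {𝒢 S} (R : Digraph → Digraph → Set) → Distinct 𝒢 →
  (∀ {G} → G ∈ 𝒢 → ∃ λ H → H ∈ S × R G H) →
  (∀ {G G′ H} → G ∈ 𝒢 → G′ ∈ 𝒢 → R G H → R G′ H → G ≐ G′) →
  length 𝒢 ≤ length S
length-≤-injection {𝒢} {S} R distinct f inj = injective⇒≤ {f = λ i → index (H∈ i)} index-injective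
  where
  H∈ : ∀ i → proj₁ (f (∈-lookup i)) ∈ S
  H∈ i = proj₁ (proj₂ (f (∈-lookup i)))
  related : ∀ i → R (lookup 𝒢 i) (lookup S (index (H∈ i)))
  related i = subst (R _) (lookup-index (H∈ i)) (proj₂ (proj₂ (f (∈-lookup i))))
  index-injective : ∀ {i j} → index (H∈ i) ≡ index (H∈ j) → i ≡ j
  index-injective {i} {j} e = lookup-injective {_≈_ = _≐_} (λ e i j → sym (e i j)) distinct i j
    (inj (∈-lookup i) (∈-lookup j) (related i)
      (subst (R _ ∘ lookup S) (sym e) (related j)))

covers-filter : ∀ {α m β k 𝒢 S} {P Q : Pred Digraph 0ℓ} (P? : Decidable P) (Q? : Decidable Q) →
  (∀ {v} → In β k v → In α m v) →
  (∀ {G v H} → G ∈ 𝒢 → P G → In β k v → del v G ≐ H → Q H) →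
  Covers α m 𝒢 S → Covers β k (filter P? 𝒢) (filter Q? S)
covers-filter P? Q? β⊆α P⇒Q cov G∈ v∈
  with G∈𝒢 , p ← ∈-filter⁻ P? G∈
  with H , H∈ , e ← cov G∈𝒢 (β⊆α v∈) = H , ∈-filter⁺ Q? H∈ (P⇒Q G∈𝒢 p v∈ e) , e

length-≤-uniform : ∀ {α m v 𝒢 S} → Distinct 𝒢 → Uniform α m 𝒢 → v < α → Covers v 1 𝒢 S →
  length 𝒢 ≤ length S
length-≤-uniform {v = v} distinct U v<α cov = length-≤-injection (λ G H → del v G ≐ H) distinct
  (λ G∈ → cov G∈ (≤-refl , m<m+n v (s≤s z≤n)))
  (λ G∈ G′∈ → uniform-del-injective U v<α G∈ G′∈)

-- The two bounds, and the renaming of outer vertices.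

Bound NonuniformBound : ℕ → Set
Bound m = ∀ α 𝒢 S → Distinct 𝒢 → Covers α m 𝒢 S → length 𝒢 ⊓ pred m ≤ length S
NonuniformBound m = ∀ α 𝒢 S → Distinct 𝒢 → ¬ Uniform α m 𝒢 → Covers α m 𝒢 S →
  length 𝒢 ⊓ m ≤ length S

in-tail : ∀ {α m v} → In (suc α) m v → In α (suc m) v
in-tail {α} {m} {v} (α<v , v<) = <⇒≤ α<v , subst (v <_) (sym (+-suc α m)) v<

in-first : ∀ {α m v} → In α 1 v → In α (suc m) v
in-first {α} {m} (α≤v , v<) = α≤v , ≤-trans v< (+-monoʳ-≤ α (s≤s z≤n))

bound-suc : ∀ {m} → NonuniformBound m → Bound (suc m)
bound-suc {m} nb α 𝒢 S distinct cov = ≤-by-cases (Uniform (suc α) m 𝒢)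
  (λ U → ≤-trans (m⊓n≤m _ _) (length-≤-uniform distinct U ≤-refl (λ G∈ v∈ → cov G∈ (in-first v∈))))
  (λ ¬U → nb (suc α) 𝒢 S distinct ¬U (λ G∈ v∈ → cov G∈ (in-tail v∈)))

bound-≤ : ∀ {m} → (∀ {k} → k < m → NonuniformBound k) → ∀ {k} → k ≤ m → Bound k
bound-≤ ih {zero}  _   = λ α 𝒢 S _ _ → ≤-trans (m⊓n≤n (length 𝒢) 0) z≤n
bound-≤ ih {suc k} k<m = bound-suc (ih k<m)

-- `z₀` is the name of `z` after a deletion: `z` itself to the left of the interval, `pred z` to its
-- right, whichever vertex `v` goes.
contract : ∀ {α m z} → Out α m z → ∃ λ z₀ → ∀ {v} → In α m v → skip v z₀ ≡ z
contract {z = z}     (inj₁ z<α)   = z , λ v∈ → skip-< (≤-trans z<α (proj₁ v∈))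
contract {z = zero}  (inj₂ α+m≤z) = zero , λ v∈ → contradiction (≤-trans (proj₂ v∈) α+m≤z) λ ()
contract {z = suc z} (inj₂ α+m≤z) = z , λ v∈ → skip-≥ (≤-pred (≤-trans (proj₂ v∈) α+m≤z))

-- Splitting a family by an outer pair.

part : (Digraph → Bool) → Bool → List Digraph → List Digraph
part t b = filter (λ G → t G Bool.≟ b)

length-parts : ∀ t b xs → length xs ≡ length (part t b xs) + length (part t (not b) xs)
length-parts t b = length-split _ _ Bool.not-¬ Bool.¬-not

-- The pair survives each deletion under names independent of the deleted vertex, so the two parts
-- have disjoint shadows. `bound` is asked at `G` and `G′` only, so that special properties of these
-- two may enter its proof.
split-outer : ∀ {α m k z z′ 𝒢 S G G′} → 0 < k → Out α m z → Out α m z′ →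
  G ∈ 𝒢 → G′ ∈ 𝒢 → G z z′ ≢ G′ z z′ →
  (∀ {X T} → X ≡ G ⊎ X ≡ G′ → Covers α m (part (λ F → F z z′) (X z z′) 𝒢) T →
    length (part (λ F → F z z′) (X z z′) 𝒢) ⊓ k ≤ length T) →
  Covers α m 𝒢 S → length 𝒢 ⊓ suc k ≤ length S
split-outer {α} {m} {k} {z} {z′} {𝒢} {S} {G} {G′} 0<k z-out z′-out G∈ G′∈ G≢G′ bound cov = begin
  length 𝒢 ⊓ suc k
    ≡⟨ cong (_⊓ suc k) (length-parts t b 𝒢) ⟩
  (length (part t b 𝒢) + length (part t (not b) 𝒢)) ⊓ suc k
    ≤⟨ ⊓-sum-suc (∈⇒0<length (∈-filter⁺ _ G∈ refl))
                 (∈⇒0<length (∈-filter⁺ _ G′∈ b′≡)) 0<k ⟩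
  length (part t b 𝒢) ⊓ k + length (part t (not b) 𝒢) ⊓ k
    ≤⟨ +-mono-≤ (bound (inj₁ refl) (covers b))
         (subst (λ c → length (part t c 𝒢) ⊓ k ≤ length (part s c S)) b′≡
           (bound (inj₂ refl) (covers (t G′)))) ⟩
  length (part s b S) + length (part s (not b) S)
    ≡⟨ length-parts s b S ⟨
  length S ∎
  where
  open ≤-Reasoning
  t s : Digraph → Bool
  t F = F z z′
  s H = H (proj₁ (contract z-out)) (proj₁ (contract z′-out))
  b : Bool
  b = t G
  b′≡ : t G′ ≡ not b
  b′≡ = Bool.¬-not (G≢G′ ∘ sym)
  covers : ∀ c → Covers α m (part t c 𝒢) (part s c S)
  covers c = covers-filter _ _ id
    (λ { {F} _ refl v∈ e → trans (sym (e _ _))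
      (cong₂ F (proj₂ (contract z-out) v∈) (proj₂ (contract z′-out) v∈)) }) cov

-- `¬ Uniform` names no difference. But if `k ≤ l` failed, no difference could exist, and by
-- stability of equality of Booleans `Uniform` would follow.
nonuniform-elim : ∀ {α m 𝒢 k l} → ¬ Uniform α m 𝒢 →
  (∀ {G G′ z z′} → G ∈ 𝒢 → G′ ∈ 𝒢 → Out α m z → Out α m z′ → G z z′ ≢ G′ z z′ → k ≤ l) →
  (∀ d {G G′ z u v} → G ∈ 𝒢 → G′ ∈ 𝒢 → Out α m z → In α m u → In α m v →
    orient d G z u ≢ orient d G′ z v → k ≤ l) →
  k ≤ l
nonuniform-elim {k = k} {l} ¬U f g with k ≤? l
... | yes k≤l = k≤l
... | no  k≰l = ⊥-elim (¬U record
  { outer = λ G∈ G′∈ o o′ → decidable-stable (_ Bool.≟ _) (λ ne → k≰l (f G∈ G′∈ o o′ ne))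
  ; cross = λ d G∈ G′∈ o u∈ v∈ → decidable-stable (_ Bool.≟ _) (λ ne → k≰l (g d G∈ G′∈ o u∈ v∈ ne)) })

-- Leading runs of one colour.

lead : Bool → (ℕ → Bool) → ℕ → ℕ → ℕ
lead a κ s zero = 0
lead a κ s (suc k) with κ s Bool.≟ a
... | yes _ = suc (lead a κ (suc s) k)
... | no  _ = 0

record IsLead (a : Bool) (κ : ℕ → Bool) (s k c : ℕ) : Set where
  field
    bounded : c ≤ k
    prefix  : ∀ {i} → s ≤ i → i < s + c → κ i ≡ a
    next    : c < k → κ (s + c) ≢ a
open IsLead

lead-isLead : ∀ a κ s k → IsLead a κ s k (lead a κ s k)
lead-isLead a κ s zero = record
  { bounded = z≤n
  ; prefix  = λ s≤i i<s → contradiction (≤-trans i<s (≤-reflexive (+-identityʳ s))) (≤⇒≯ s≤i)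
  ; next    = λ ()
  }
lead-isLead a κ s (suc k) with κ s Bool.≟ a | lead-isLead a κ (suc s) k
... | no κs≢a | _ = record
  { bounded = z≤n
  ; prefix  = λ s≤i i<s → contradiction (≤-trans i<s (≤-reflexive (+-identityʳ s))) (≤⇒≯ s≤i)
  ; next    = λ _ → κs≢a ∘ trans (cong κ (sym (+-identityʳ s)))
  }
... | yes κs≡a | ih = record
  { bounded = s≤s (bounded ih)
  ; prefix  = λ s≤i i< → case m≤n⇒m<n∨m≡n s≤i of λ
      { (inj₁ s<i)  → prefix ih s<i (≤-trans i< (≤-reflexive (+-suc s _)))
      ; (inj₂ refl) → κs≡a }
  ; next    = λ { (s≤s c<k) → next ih c<k ∘ trans (cong κ (sym (+-suc s _))) }
  }

lead-≥ : ∀ {a κ s k c} → c ≤ k → (∀ {i} → s ≤ i → i < s + c → κ i ≡ a) → c ≤ lead a κ s k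
lead-≥ {a} {κ} {s} {k} {c} c≤k pre with c ≤? lead a κ s k
... | yes c≤ = c≤
... | no  c≰ = contradiction (pre (m≤m+n s _) (+-monoʳ-< s (≰⇒> c≰)))
                 (next (lead-isLead a κ s k) (≤-trans (≰⇒> c≰) c≤k))

lead-unique : ∀ {a κ s k c} → IsLead a κ s k c → lead a κ s k ≡ c
lead-unique {a} {κ} {s} {k} {c} l with m≤n⇒m<n∨m≡n (lead-≥ (bounded l) (prefix l))
... | inj₂ e  = sym e
... | inj₁ c< = contradiction (prefix (lead-isLead a κ s k) (m≤m+n s c) (+-monoʳ-< s c<))
                  (next l (≤-trans c< (bounded (lead-isLead a κ s k))))

distinct-pair : ∀ {xs} → Distinct xs → 2 ≤ length xs →
  ∃ λ G → ∃ λ G′ → G ∈ xs × G′ ∈ xs × ¬ G ≐ G′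
distinct-pair ((G≢ ∷ _) ∷ _) _ = _ , _ , here refl , there (here refl) , G≢
distinct-pair {_ ∷ []} _ (s≤s ())

length-≤-1 : ∀ {X xs} → Distinct xs → (∀ {F} → F ∈ xs → F ≐ X) → length xs ≤ 1
length-≤-1 {X} distinct ≐X = length-≤-injection {S = X ∷ []} _≐_ distinct
  (λ F∈ → X , here refl , ≐X F∈) (λ _ _ e e′ i j → trans (e i j) (sym (e′ i j)))

-- Colouring by adjacency to an outer vertex.

module Coloured
  {m} (0<m : 0 < m)
  (nonuniform : ∀ {k} → k ≤ m → NonuniformBound k)
  (bound : ∀ {k} → k ≤ suc m → Bound k)
  {α 𝒢 S} (distinct : Distinct 𝒢) (cov : Covers α (suc m) 𝒢 S)
  (d : Bool) {z} (z-out : Out α (suc m) z)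
  where

  z₀ : ℕ
  z₀ = proj₁ (contract z-out)

  -- The colour of a vertex i of G is its adjacency to z, which is called z₀ after
  -- the deletion of a vertex of the interval.
  κ κ⁻ : Digraph → ℕ → Bool
  κ  G i = orient d G z i
  κ⁻ H i = orient d H z₀ i

  κ-del : ∀ {G v H} → In α (suc m) v → del v G ≐ H → ∀ i → κ⁻ H i ≡ κ G (skip v i)
  κ-del {G} {v} v∈ e i = trans (orient-del d e z₀ i)
    (cong (λ y → orient d G y (skip v i)) (proj₂ (contract z-out) v∈))

  Goal : Set
  Goal = length 𝒢 ⊓ suc m ≤ length S

  module FirstColour where

    t s : Digraph → Bool
    t G = κ G α
    s H = κ⁻ H α

    α+1∈ : In α (suc m) (suc α)
    α+1∈ = in-tail (≤-refl , m<m+n (suc α) 0<m)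

    s-del : ∀ {G v H} → In (suc α) m v → del v G ≐ H → s H ≡ t G
    s-del {G} v∈ e = trans (κ-del (in-tail v∈) e α) (cong (κ G) (skip-< (proj₁ v∈)))

    -- In continuation form, as the part either has the bound with cap `m` or, being uniform and
    -- large, yields the goal directly: deleting `α` is injective on it and gives first colour `c`,
    -- and a digraph of the other first colour adds one.
    one-part : ∀ {X X′} → X ∈ 𝒢 → X′ ∈ 𝒢 → t X ≢ t X′ →
      (length (part t (t X) 𝒢) ⊓ m ≤ length (part s (t X) S) → Goal) → Goal
    one-part {X} {X′} X∈ X′∈ tX≢ k = ≤-by-cases (Uniform (suc α) m 𝒢X) uniform
      (λ ¬U → k (nonuniform ≤-refl (suc α) 𝒢X _ distinctX ¬U coversX))
      where
      𝒢X : List Digraph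
      𝒢X = part t (t X) 𝒢
      distinctX : Distinct 𝒢X
      distinctX = AllPairsₚ.filter⁺ _ distinct
      coversX : Covers (suc α) m 𝒢X (part s (t X) S)
      coversX = covers-filter _ _ in-tail (λ _ tF≡ v∈ e → trans (s-del v∈ e) tF≡) cov
      c : Bool
      c = κ X (suc α)
      z-out⁺ : Out (suc α) m z
      z-out⁺ = [ inj₁ ∘ m≤n⇒m≤1+n , inj₂ ∘ subst (_≤ z) (+-suc α m) ]′ z-out
      -- Deleting `suc α` preserves the first colour, which differs from `c` in `X` or in `X′`.
      other : 0 < length (part s (not c) S)
      other with t X Bool.≟ c
      ... | yes tX≡c with H , H∈ , e ← cov X′∈ α+1∈ = ∈⇒0<length (∈-filter⁺ _ H∈
        (trans (s-del (≤-refl , m<m+n (suc α) 0<m) e)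
          (trans (Bool.¬-not (tX≢ ∘ sym)) (cong not tX≡c))))
      ... | no  tX≢c with H , H∈ , e ← cov X∈ α+1∈ = ∈⇒0<length (∈-filter⁺ _ H∈
        (trans (s-del (≤-refl , m<m+n (suc α) 0<m) e) (Bool.¬-not tX≢c)))
      uniform : Uniform (suc α) m 𝒢X → Goal
      uniform U with m ≤? length 𝒢X
      -- The cap `pred m` is not exceeded here, so the uniform bound loses nothing.
      ... | no m≰ = k (begin
        length 𝒢X ⊓ m           ≤⟨ m⊓n≤m _ m ⟩
        length 𝒢X               ≡⟨ m≤n⇒m⊓n≡m (<⇒≤pred (≰⇒> m≰)) ⟨
        length 𝒢X ⊓ pred m      ≤⟨ bound (n≤1+n m) (suc α) 𝒢X _ distinctX coversX ⟩
        length (part s (t X) S) ∎)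
        where open ≤-Reasoning
      ... | yes m≤ = begin
        length 𝒢 ⊓ suc m                                  ≤⟨ m⊓n≤n (length 𝒢) (suc m) ⟩
        suc m                                             ≡⟨ +-comm 1 m ⟩
        m + 1                                             ≤⟨ +-mono-≤ (≤-trans m≤ 𝒢X≤) other ⟩
        length (part s c S) + length (part s (not c) S)   ≡⟨ length-parts s c S ⟨
        length S                                          ∎
        where
        open ≤-Reasoning
        𝒢X≤ : length 𝒢X ≤ length (part s c S)
        𝒢X≤ = length-≤-uniform distinctX U ≤-refl (covers-filter _ _ in-first
          (λ { {F} {v} F∈ tF≡ v∈ e →
            let v≡α = ≤-antisym (≤-pred (≤-trans (proj₂ v∈) (≤-reflexive (+-comm α 1)))) (proj₁ v∈) in
            trans (κ-del (in-first v∈) e α)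
              (trans (cong (κ F) (skip-≥ (≤-reflexive v≡α)))
                (cross U d (∈-filter⁺ _ F∈ tF≡) (∈-filter⁺ _ X∈ refl) z-out⁺
                  (≤-refl , m<m+n (suc α) 0<m) (≤-refl , m<m+n (suc α) 0<m))) }) cov)

    differing : ∀ {G G′} → G ∈ 𝒢 → G′ ∈ 𝒢 → t G ≢ t G′ → Goal
    differing {G} {G′} G∈ G′∈ tG≢ =
      one-part G∈ G′∈ tG≢ λ bG → one-part G′∈ G∈ (tG≢ ∘ sym) λ bG′ → begin
        length 𝒢 ⊓ suc m
          ≡⟨ cong (_⊓ suc m) (length-parts t (t G) 𝒢) ⟩
        (length (part t (t G) 𝒢) + length (part t (not (t G)) 𝒢)) ⊓ suc m
          ≤⟨ ⊓-sum-suc (∈⇒0<length (∈-filter⁺ _ G∈ refl))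
                       (∈⇒0<length (∈-filter⁺ _ G′∈ tG′≡)) 0<m ⟩
        length (part t (t G) 𝒢) ⊓ m + length (part t (not (t G)) 𝒢) ⊓ m
          ≤⟨ +-mono-≤ bG (subst (λ c → length (part t c 𝒢) ⊓ m ≤ length (part s c S)) tG′≡ bG′) ⟩
        length (part s (t G) S) + length (part s (not (t G)) S)
          ≡⟨ length-parts s (t G) S ⟨
        length S ∎
      where
      open ≤-Reasoning
      tG′≡ : t G′ ≡ not (t G)
      tG′≡ = Bool.¬-not (tG≢ ∘ sym)

  module Sweep
    {a} (first≡a : ∀ {G} → G ∈ 𝒢 → κ G α ≡ a)
    {G₁ u₁} (G₁∈ : G₁ ∈ 𝒢) (u₁∈ : In α (suc m) u₁) (κ≢a : κ G₁ u₁ ≢ a)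
    where

    -- f discards the first vertex, so that deletions to the left of the first vertex not
    -- coloured a turn f = r into g = r, and those to its right turn f ≥ r into g > r.
    f g : Digraph → ℕ
    f G = lead a (κ G) (suc α) m
    g H = lead a (κ⁻ H) α m

    f-isLead : ∀ G → IsLead a (κ G) (suc α) m (f G)
    f-isLead G = lead-isLead a (κ G) (suc α) m

    prefix≡a : ∀ {G i} → G ∈ 𝒢 → α ≤ i → i ≤ α + f G → κ G i ≡ a
    prefix≡a {G} G∈ α≤i i≤ with m≤n⇒m<n∨m≡n α≤i
    ... | inj₁ α<i  = prefix (f-isLead G) α<i (s≤s i≤)
    ... | inj₂ refl = first≡a G∈

    first-<m : f G₁ < m
    first-<m = ≤∧≢⇒< (bounded (f-isLead G₁)) λ f≡m → κ≢a (prefix≡a G₁∈ (proj₁ u₁∈)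
      (≤-pred (≤-trans (proj₂ u₁∈) (≤-reflexive (trans (+-suc α m) (cong (λ k → suc (α + k)) (sym f≡m)))))))

    in-left : ∀ {r v} → r ≤ m → In α (suc r) v → In α (suc m) v
    in-left r≤m (α≤v , v<) = α≤v , ≤-trans v< (+-monoʳ-≤ α (s≤s r≤m))

    end-right : ∀ {r} → r ≤ m → α + suc r + (m ∸ r) ≡ α + suc m
    end-right {r} r≤m = trans (+-assoc α (suc r) (m ∸ r)) (cong ((α +_) ∘ suc) (m+[n∸m]≡n r≤m))

    in-right : ∀ {r v} → r ≤ m → In (α + suc r) (m ∸ r) v → In α (suc m) v
    in-right {r} {v} r≤m (≤v , v<) = ≤-trans (m≤m+n α (suc r)) ≤v , subst (v <_) (end-right r≤m) v<

    out-right : ∀ {r} → r ≤ m → Out (α + suc r) (m ∸ r) z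
    out-right {r} r≤m = [ (λ z<α → inj₁ (≤-trans z<α (m≤m+n α (suc r))))
                        , inj₂ ∘ subst (_≤ z) (sym (end-right r≤m)) ]′ z-out

    g-left : ∀ {r G v H} → r ≤ m → G ∈ 𝒢 → f G ≡ r → In α (suc r) v → del v G ≐ H → g H ≡ r
    g-left {G = G} {v} {H} r≤m G∈ refl v∈ e = lead-unique record
      { bounded = r≤m
      ; prefix  = λ {i} α≤i i< → trans (κ-del (in-left r≤m v∈) e i) (shifted i α≤i i<)
      ; next    = λ r<m κ≡a → next (f-isLead G) r<m
          (trans (cong (κ G) (sym (skip-≥ v≤)))
            (trans (sym (κ-del (in-left r≤m v∈) e (α + f G))) κ≡a))
      }
      where
      v≤ : v ≤ α + f G
      v≤ = ≤-pred (≤-trans (proj₂ v∈) (≤-reflexive (+-suc α (f G))))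
      shifted : ∀ i → α ≤ i → i < α + f G → κ G (skip v i) ≡ a
      shifted i α≤i i< with i <? v
      ... | yes i<v rewrite skip-< i<v = prefix≡a G∈ α≤i (<⇒≤ i<)
      ... | no  i≮v rewrite skip-≥ (≮⇒≥ i≮v) = prefix≡a G∈ (m≤n⇒m≤1+n α≤i) i<

    -- The `suc r` vertices before this interval are coloured `a` and survive. Only a lower bound is
    -- claimed: for `f G = r` the interval starts with the first vertex not coloured `a`, whose
    -- deletion may extend the run.
    g-right : ∀ {r G v H} → r < m → G ∈ 𝒢 → r ≤ f G → In (α + suc r) (m ∸ r) v → del v G ≐ H →
      suc r ≤ g H
    g-right {r} {G} r<m G∈ r≤f v∈ e = lead-≥ r<m λ {i} α≤i i< →
      trans (κ-del (in-right (<⇒≤ r<m) v∈) e i)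
        (trans (cong (κ G) (skip-< (≤-trans i< (proj₁ v∈))))
          (prefix≡a G∈ α≤i (≤-trans (≤-pred (≤-trans i< (≤-reflexive (+-suc α r)))) (+-monoʳ-≤ α r≤f))))

    below level above : (Digraph → ℕ) → ℕ → List Digraph → List Digraph
    below h r = filter (λ X → h X <? r)
    level h r = filter (λ X → h X ≟ r)
    above h r = filter (λ X → r ≤? h X)

    covers-left : ∀ {r} → r ≤ m → Covers α (suc r) (level f r 𝒢) (level g r S)
    covers-left r≤m = covers-filter _ _ (in-left r≤m) (g-left r≤m) cov

    covers-right : ∀ {r} → r < m → Covers (α + suc r) (m ∸ r) (above f r 𝒢) (above g (suc r) S)
    covers-right r<m = covers-filter _ _ (in-right (<⇒≤ r<m)) (g-right r<m) cov

    level-distinct : ∀ r → Distinct (level f r 𝒢)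
    level-distinct r = AllPairsₚ.filter⁺ _ distinct

    level-bound : ∀ {r} → r ≤ m → length (level f r 𝒢) ⊓ r ≤ length (level g r S)
    level-bound {r} r≤m = bound (s≤s r≤m) α _ _ (level-distinct r) (covers-left r≤m)

    -- The counting condition for `q = suc r`: `f` omits the vertex `α`, so `f G < suc r` allows
    -- `suc r` leading vertices coloured `a`.
    Full : ℕ → Set
    Full r = suc r ≤ length (below f (suc r) 𝒢)

    -- Since `c` is not full, its level has at most `c` members, so the cap in `level-bound` does
    -- not bind.
    below-bound : ∀ {r} → r ≤ m → (∀ {c} → c < r → ¬ Full c) →
      length (below f r 𝒢) ≤ length (below g r S)
    below-bound r≤m ¬full = length-below-mono f g 𝒢 S _ λ {c} c<r →
      let c≤m = ≤-trans (<⇒≤ c<r) r≤m in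
      ≤-trans (≤-reflexive (sym (m≤n⇒m⊓n≡m (≤-trans
        (m≤n+m _ (length (below f c 𝒢)))
        (≤-trans (≤-reflexive (sym (length-below-suc f c 𝒢))) (≤-pred (≰⇒> (¬full c<r))))))))
        (level-bound c≤m)

    no-full : (∀ {c} → c < m → ¬ Full c) → Goal
    no-full ¬full = begin
      length 𝒢 ⊓ suc m
        ≡⟨ cong (_⊓ suc m) (split f (λ {G} → bounded (f-isLead G)) 𝒢) ⟩
      (length (below f m 𝒢) + length (level f m 𝒢)) ⊓ suc m
        -- With `x = 0` and `q = 1`: `G₁` has a vertex not coloured `a`, hence lies below `m`, and
        -- this one member makes up for the cap `m` in place of `suc m`.
        ≤⟨ ⊓-sum-left {t = length (below f m 𝒢)} {x = 0} {q = 1}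
             (≤-trans (∈⇒0<length (∈-filter⁺ _ G₁∈ first-<m)) (m≤m+n _ 0)) ≤-refl ⟩
      length (below f m 𝒢) + 0 + length (level f m 𝒢) ⊓ m
        ≡⟨ cong (_+ length (level f m 𝒢) ⊓ m) (+-identityʳ _) ⟩
      length (below f m 𝒢) + length (level f m 𝒢) ⊓ m
        ≤⟨ +-mono-≤ (below-bound ≤-refl ¬full) (level-bound ≤-refl) ⟩
      length (below g m S) + length (level g m S)
        ≡⟨ split g (λ {H} → bounded (lead-isLead a (κ⁻ H) α m)) S ⟨
      length S ∎
      where
      open ≤-Reasoning
      split : ∀ h → (∀ {X} → h X ≤ m) → ∀ xs →
        length xs ≡ length (below h m xs) + length (level h m xs)
      split h h≤m = length-split _ _ <⇒≢ (λ h≮m → ≤-antisym h≤m (≮⇒≥ h≮m))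

    module FirstFull {r} (r<m : r < m) (full : Full r) (¬full : ∀ {c} → c < r → ¬ Full c) where

      T x Y : ℕ
      T = length (below f r 𝒢)
      x = length (level f r 𝒢)
      Y = length (above f r 𝒢)

      full′ : suc r ≤ T + x
      full′ = ≤-trans full (≤-reflexive (length-below-suc f r 𝒢))

      T≤r : T ≤ r
      T≤r = case-r r ≤-refl
        where
        case-r : ∀ c → c ≤ r → length (below f c 𝒢) ≤ c
        case-r zero    _   = length-below-mono f f 𝒢 [] zero λ ()
        case-r (suc c) c<r = m≤n⇒m≤1+n (≤-pred (≰⇒> (¬full c<r)))

      0<x : 0 < x
      0<x = +-cancelˡ-≤ r 1 x (begin
        r + 1 ≡⟨ +-comm r 1 ⟩
        suc r ≤⟨ full′ ⟩
        T + x ≤⟨ +-monoˡ-≤ x T≤r ⟩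
        r + x ∎)
        where open ≤-Reasoning

      assemble : ∀ {l k} → l ≤ length (level g r S) → k ≤ length (above g (suc r) S) →
        T + l + k ≤ length S
      assemble {l} {k} l≤ k≤ = begin
        T + l + k
          ≤⟨ +-mono-≤ (+-mono-≤ (below-bound (<⇒≤ r<m) ¬full) l≤) k≤ ⟩
        length (below g r S) + length (level g r S) + length (above g (suc r) S)
          ≡⟨ cong (_+ length (above g (suc r) S)) (length-below-suc g r S) ⟨
        length (below g (suc r) S) + length (above g (suc r) S)
          ≡⟨ length-split _ _ <⇒≱ ≮⇒≥ S ⟨
        length S ∎
        where open ≤-Reasoning

      length-𝒢 : length 𝒢 ≡ T + Y
      length-𝒢 = length-split _ _ <⇒≱ ≮⇒≥ 𝒢

      -- Level `r` counts in `x` through deletions on the left and in `Y` through those on the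
      -- right, with disjoint images. The caps `q` and `k` share out `suc m`: as `suc r` and
      -- `m ∸ r`, or as `r` and `suc (m ∸ r)`.
      goal : ∀ {q k} → q ≤ T + x → suc m ≤ q + k →
        x ⊓ q ≤ length (level g r S) → Y ⊓ k ≤ length (above g (suc r) S) → Goal
      goal {q} {k} q≤ m≤ x≤ Y≤ = begin
        length 𝒢 ⊓ suc m  ≡⟨ cong (_⊓ suc m) length-𝒢 ⟩
        (T + Y) ⊓ suc m   ≤⟨ ⊓-sum-left {t = T} q≤ m≤ ⟩
        T + x ⊓ q + Y ⊓ k ≤⟨ assemble x≤ Y≤ ⟩
        length S          ∎
        where open ≤-Reasoning

      β k : ℕ
      β = α + suc r
      k = m ∸ r

      0<k : 0 < k
      0<k = m<n⇒0<n∸m r<m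

      α<β : α < β
      α<β = m<m+n α (s≤s z≤n)

      level⇒above : ∀ {G} → G ∈ level f r 𝒢 → G ∈ above f r 𝒢
      level⇒above G∈ with G∈𝒢 , f≡r ← ∈-filter⁻ (λ X → f X ≟ r) {xs = 𝒢} G∈ =
        ∈-filter⁺ (λ X → r ≤? f X) G∈𝒢 (≤-reflexive (sym f≡r))

      -- The vertex `β` is not coloured `a` in `X` but would be in a member with `f F > r`;
      -- uniformity makes these colours equal.
      uniform⇒level : ∀ {𝒴 X} → Uniform β k 𝒴 → (∀ {F} → F ∈ 𝒴 → F ∈ above f r 𝒢) →
        X ∈ 𝒴 → f X ≡ r → ∀ {F} → F ∈ 𝒴 → F ∈ level f r 𝒢
      uniform⇒level {X = X} U 𝒴⊆ X∈ fX≡r {F} F∈ with ∈-filter⁻ (λ G → r ≤? f G) (𝒴⊆ F∈)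
      ... | F∈𝒢 , r≤f with m≤n⇒m<n∨m≡n r≤f
      ...   | inj₂ r≡f = ∈-filter⁺ _ F∈𝒢 (sym r≡f)
      ...   | inj₁ r<f = contradiction
        (trans (cong (κ X) (trans (cong (suc α +_) fX≡r) (sym (+-suc α r))))
          (trans (cross U d X∈ F∈ (out-right (<⇒≤ r<m)) β∈ β∈)
            (prefix≡a F∈𝒢 (<⇒≤ α<β) (+-monoʳ-≤ α r<f))))
        (next (f-isLead X) (subst (_< m) (sym fX≡r) r<m))
        where
        β∈ : In β k β
        β∈ = ≤-refl , m<m+n β 0<k

      X₀ : Digraph
      X₀ = proj₁ (0<length⇒∈ (level f r 𝒢) 0<x)
      X₀∈ : X₀ ∈ level f r 𝒢
      X₀∈ = proj₂ (0<length⇒∈ (level f r 𝒢) 0<x)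

      f≡r : ∀ {G} → G ∈ level f r 𝒢 → f G ≡ r
      f≡r = proj₂ ∘ ∈-filter⁻ (λ G → f G ≟ r) {xs = 𝒢}

      -- By `uniform⇒level` all of `above f r 𝒢` lies in level `r`. The vertex `α` lies before the
      -- right interval, so deleting it is injective, and the images lie in level `r` of `S`.
      right-uniform : Uniform β k (above f r 𝒢) → Goal
      right-uniform U = begin
        length 𝒢 ⊓ suc m ≤⟨ m⊓n≤m (length 𝒢) (suc m) ⟩
        length 𝒢         ≡⟨ trans length-𝒢 (sym (+-identityʳ _)) ⟩
        T + Y + 0        ≤⟨ assemble Y≤ z≤n ⟩
        length S         ∎
        where
        open ≤-Reasoning
        Y≤ : Y ≤ length (level g r S)
        Y≤ = length-≤-uniform (AllPairsₚ.filter⁺ _ distinct) U α<β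
          (λ F∈ v∈ → covers-left (<⇒≤ r<m) (uniform⇒level U id (level⇒above X₀∈) (f≡r X₀∈) F∈)
            (in-first v∈))

      right-nonuniform : ¬ Uniform β k (above f r 𝒢) → x ⊓ suc r ≤ length (level g r S) → Goal
      right-nonuniform ¬U x≤ = goal full′ (s≤s (≤-reflexive (sym (m+[n∸m]≡n (<⇒≤ r<m))))) x≤
        (nonuniform (m∸n≤m m r) β _ _ (AllPairsₚ.filter⁺ _ distinct) ¬U (covers-right r<m))

      -- Two members of the level differ at a pair (i, j) of vertices on the left; splitting
      -- by this pair gains one over the bound on the right and makes up for the weaker
      -- bound on the left.
      left-uniform : Uniform α (suc r) (level f r 𝒢) → 2 ≤ x → Goal
      left-uniform U 2≤x with length 𝒢 ⊓ suc m ≤? length S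
      ... | yes done = done
      ... | no ¬done with G , G′ , G∈ , G′∈ , G≢G′ ← distinct-pair (level-distinct r) 2≤x =
        contradiction (uniform-ext U G∈ G′∈ λ {i} {j} i∈ j∈ →
          decidable-stable (_ Bool.≟ _) λ ne → ¬done
            (goal (≤-trans (n≤1+n r) full′)
              (≤-reflexive (sym (trans (+-suc r k) (cong suc (m+[n∸m]≡n (<⇒≤ r<m))))))
              (level-bound (<⇒≤ r<m))
              (split-outer 0<k (inj₁ (proj₂ i∈)) (inj₁ (proj₂ j∈))
                (level⇒above G∈) (level⇒above G′∈) ne
                (λ { (inj₁ refl) → part-bound i j G∈ ; (inj₂ refl) → part-bound i j G′∈ })
                (covers-right r<m)))) G≢G′
        where
        part-bound : ∀ i j {X T} → X ∈ level f r 𝒢 →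
          let 𝒴 = part (λ F → F i j) (X i j) (above f r 𝒢) in
          Covers β k 𝒴 T → length 𝒴 ⊓ k ≤ length T
        part-bound i j {X} {T} X∈ covers = ≤-by-cases (Uniform β k 𝒴)
          (λ U′ → ≤-trans (m⊓n≤m _ k) (≤-trans (length-≤-1 distinct𝒴 (single U′))
            (∈⇒0<length (proj₁ (proj₂ (covers X∈𝒴 (≤-refl , m<m+n β 0<k)))))))
          (λ ¬U → nonuniform (m∸n≤m m r) β 𝒴 T distinct𝒴 ¬U covers)
          where
          𝒴 : List Digraph
          𝒴 = part (λ F → F i j) (X i j) (above f r 𝒢)
          distinct𝒴 : Distinct 𝒴
          distinct𝒴 = AllPairsₚ.filter⁺ _ (AllPairsₚ.filter⁺ _ distinct)
          X∈𝒴 : X ∈ 𝒴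
          X∈𝒴 = ∈-filter⁺ _ (level⇒above X∈) refl
          -- `U′` fixes the adjacencies among the left vertices and `U` all others.
          single : Uniform β k 𝒴 → ∀ {F} → F ∈ 𝒴 → F ≐ X
          single U′ F∈ = uniform-ext U
            (uniform⇒level U′ (proj₁ ∘ ∈-filter⁻ _) X∈𝒴 (f≡r X∈) F∈) X∈
            (λ i∈ j∈ → outer U′ F∈ X∈𝒴 (inj₁ (proj₂ i∈)) (inj₁ (proj₂ j∈)))

      first-full : Goal
      first-full = ≤-by-cases (Uniform β k (above f r 𝒢)) right-uniform λ ¬U →
        ≤-by-cases (Uniform α (suc r) (level f r 𝒢))
          (λ U → case 2 ≤? x of λ
            { (yes 2≤x) → left-uniform U 2≤x
            ; (no  2≰x) → right-nonuniform ¬U (≤-trans (m⊓n≤m x (suc r)) (≤-trans (≤-pred (≰⇒> 2≰x))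
                (∈⇒0<length (proj₁ (proj₂ (covers-left (<⇒≤ r<m) X₀∈ (≤-refl , α<β))))))) })
          (λ ¬U′ → right-nonuniform ¬U
            (nonuniform r<m α _ _ (level-distinct r) ¬U′ (covers-left (<⇒≤ r<m))))

    sweep : Goal
    sweep with least (λ r → suc r ≤? length (below f (suc r) 𝒢)) m
    ... | inj₁ (r , r<m , full , ¬full) = FirstFull.first-full r<m full ¬full
    ... | inj₂ ¬full                    = no-full ¬full

  coloured : ∀ {G G′ u v} → G ∈ 𝒢 → G′ ∈ 𝒢 → In α (suc m) u → In α (suc m) v → κ G u ≢ κ G′ v → Goal
  coloured {G} {G′} {u} {v} G∈ G′∈ u∈ v∈ κ≢ with length 𝒢 ⊓ suc m ≤? length S
  ... | yes done = done
  -- With `a` the colour of `α` in `G`, at least one of the two differing colours is not `a`.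
  ... | no ¬done with κ G u Bool.≟ κ G α
  ...   | no  κ≢a = Sweep.sweep first≡ G∈ u∈ κ≢a
    where
    first≡ : ∀ {F} → F ∈ 𝒢 → κ F α ≡ κ G α
    first≡ F∈ = decidable-stable (_ Bool.≟ _) (¬done ∘ FirstColour.differing F∈ G∈)
  ...   | yes κ≡a = Sweep.sweep first≡ G′∈ v∈ (κ≢ ∘ trans κ≡a ∘ sym)
    where
    first≡ : ∀ {F} → F ∈ 𝒢 → κ F α ≡ κ G α
    first≡ F∈ = decidable-stable (_ Bool.≟ _) (¬done ∘ FirstColour.differing F∈ G∈)

-- Induction on the length of the interval.

nonuniform-bound : ∀ m → NonuniformBound m
nonuniform-bound = <-rec NonuniformBound step
  where
  step : ∀ m → (∀ {k} → k < m → NonuniformBound k) → NonuniformBound m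
  step zero _ α 𝒢 S _ _ _ = ≤-trans (m⊓n≤n (length 𝒢) 0) z≤n
  -- Handled apart, because the split below needs a positive cap for its parts.
  step 1 _ α [] S _ _ _ = z≤n
  step 1 _ α 𝒢@(_ ∷ _) S _ _ cov = ≤-trans (m⊓n≤n (length 𝒢) 1)
    (∈⇒0<length (proj₁ (proj₂ (cov (here refl) (≤-refl , m<m+n α (s≤s z≤n))))))
  step (suc m@(suc _)) ih α 𝒢 S distinct ¬U cov = nonuniform-elim ¬U
    (λ G∈ G′∈ z-out z′-out ne → split-outer (s≤s z≤n) z-out z′-out G∈ G′∈ ne
      -- A part may be uniform, so only the cap `m` is available; the split restores the missing
      -- one.
      (λ _ → bound-≤ ih ≤-refl α _ _ (AllPairsₚ.filter⁺ _ distinct)) cov)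
    (λ d G∈ G′∈ z-out u∈ v∈ ne → Coloured.coloured (s≤s z≤n) (ih ∘ s≤s) (bound-≤ ih) distinct cov
      d z-out G∈ G′∈ u∈ v∈ ne)

-- Adjacency matrices as digraphs.

at : ∀ {A : Set} → A → ∀ {n} → Vec A n → ℕ → A
at d []       _       = d
at d (x ∷ xs) zero    = x
at d (x ∷ xs) (suc i) = at d xs i

at-removeAt : ∀ {A : Set} (d : A) {n} (xs : Vec A (suc n)) v i →
  at d (removeAt xs v) i ≡ at d xs (skip (toℕ v) i)
at-removeAt d (x ∷ xs)         zero    i       = refl
at-removeAt d (x ∷ xs@(_ ∷ _)) (suc v) zero    = refl
at-removeAt d (x ∷ xs@(_ ∷ _)) (suc v) (suc i) = at-removeAt d xs v i

at-map : ∀ {A B : Set} (f : A → B) (d : A) {n} (xs : Vec A n) i →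
  at (f d) (Vec.map f xs) i ≡ f (at d xs i)
at-map f d []       i       = refl
at-map f d (x ∷ xs) zero    = refl
at-map f d (x ∷ xs) (suc i) = at-map f d xs i

at-injective : ∀ {A : Set} (d : A) {n} {xs ys : Vec A n} → (∀ i → at d xs i ≡ at d ys i) → xs ≡ ys
at-injective d {xs = []}     {[]}     _ = refl
at-injective d {xs = x ∷ xs} {y ∷ ys} e = cong₂ _∷_ (e zero) (at-injective d (e ∘ suc))

removeAt-replicate : ∀ {A : Set} {n} (d : A) (v : Fin (suc n)) →
  removeAt (replicate (suc n) d) v ≡ replicate n d
removeAt-replicate d zero = refl
removeAt-replicate {n = suc n} d (suc v) = cong (d ∷_) (removeAt-replicate d v)

-- Pairs outside the vertex set are sent to false.
digraph : ∀ {n} → AdjMat n → Digraph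
digraph A i j = at false (at (replicate _ false) A i) j

digraph-injective : ∀ {n} {A B : AdjMat n} → digraph A ≐ digraph B → A ≡ B
digraph-injective e = at-injective _ λ i → at-injective false (e i)

digraph-delete : ∀ {n} (A : AdjMat (suc n)) v → del (toℕ v) (digraph A) ≐ digraph (delete A v)
digraph-delete {n} A v i j = sym (begin
  at false (at (replicate n false) (delete A v) i) j
    -- The default row is written as a deletion from the longer default row, since `at-map` needs a
    -- default of the form `f d`.
    ≡⟨ cong (λ d → at false (at d (delete A v) i) j) (removeAt-replicate false v) ⟨
  at false (at (removeAt (replicate (suc n) false) v) (delete A v) i) j
    ≡⟨ cong (λ row → at false row j) (at-map (λ row → removeAt row v) _ (removeAt A v) i) ⟩
  at false (removeAt (at (replicate (suc n) false) (removeAt A v) i) v) j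
    ≡⟨ at-removeAt false (at _ (removeAt A v) i) v j ⟩
  at false (at (replicate (suc n) false) (removeAt A v) i) (skip (toℕ v) j)
    ≡⟨ cong (λ row → at false row (skip (toℕ v) j)) (at-removeAt _ A v i) ⟩
  digraph A (skip (toℕ v) i) (skip (toℕ v) j) ∎)
  where open ≡-Reasoning

theorem1p1 : (m : ℕ) → 136 ≤ suc m →
    (𝒢 : List (AdjMat (suc m))) → All IsGraph 𝒢 → Unique 𝒢 →
    length 𝒢 < suc m →
    (S : List (AdjMat m)) → Unique S → (∀ (H : AdjMat m) → (H ∈ S) ⇔ InShadow 𝒢 H) →
    length 𝒢 ≤ length S
theorem1p1 m _ 𝒢 _ unique 𝒢<n S _ S⇔ = begin
  length 𝒢                   ≡⟨ m≤n⇒m⊓n≡m (≤-pred 𝒢<n) ⟨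
  length 𝒢 ⊓ m               ≡⟨ cong (_⊓ m) (length-map digraph 𝒢) ⟨
  -- The interval is the whole vertex set, outside which every entry is `false`; the family is
  -- uniform there, so it is `Bound (suc m)` that applies, with cap `m`.
  length (map digraph 𝒢) ⊓ m ≤⟨ bound-suc (nonuniform-bound m) 0 _ _ distinct covers ⟩
  length (map digraph S)     ≡⟨ length-map digraph S ⟩
  length S                   ∎
  where
  open ≤-Reasoning
  distinct : Distinct (map digraph 𝒢)
  distinct = AllPairsₚ.map⁺ (AllPairs.map (λ A≢B → A≢B ∘ digraph-injective) unique)
  covers : Covers 0 (suc m) (map digraph 𝒢) (map digraph S)
  covers G∈ (_ , v<) with A , A∈ , refl ← ∈-map⁻ digraph G∈ =
    digraph (delete A (fromℕ< v<)) ,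
    ∈-map⁺ digraph (Equivalence.from (S⇔ _) (A , A∈ , fromℕ< v< , refl)) ,
    subst (λ v → del v (digraph A) ≐ digraph (delete A (fromℕ< v<))) (toℕ-fromℕ< v<)
      (digraph-delete A (fromℕ< v<))
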